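{- Let $\mathcal{M}=(E,\mathcal{T})$ be a simple oriented matroid that is not acyclic, on ground set $E$, with set of topes $\mathcal{T}$. Let $\boldsymbol{\Gamma}$ be the simple graph with vertex set $\mathcal{T}$ in which a pair $\{T',T''\}\subset\mathcal{T}$ is an edge if and only if $(T')^+\cup(T'')^+=E$. Then the three-tope committees for $\mathcal{M}$ are precisely the vertex sets of the triangles in $\boldsymbol{\Gamma}$; that is, a $3$-subset $\{T',T'',T'''\}\subset\mathcal{T}$ is a tope committee for $\mathcal{M}$ if and only if its three elements are pairwise adjacent in $\boldsymbol{\Gamma}$.
   Context: An oriented matroid is called simple here if it has no loops, no parallel elements and no antiparallel elements. Topes are the maximal covectors, regarded as sign vectors $T\in\{+,-\}^E$ (there are no loops). $\mathcal{M}$ is acyclic if it has the tope all of whose components are $+$. For a sign vector $F$, $F^+$ and $F^-$ denote its positive and negative parts, i.e. the sets of $e\in E$ with $F(e)=+$ and $F(e)=-$, respectively. For $e\in E$, the positive halfspace corresponding to $e$ is $\mathcal{T}_e^+:=\{T\in\mathcal{T}: T(e)=+\}$. A tope committee for $\mathcal{M}$ is a subset $\mathcal{K}^{\ast}\subset\mathcal{T}$ such that $|\mathcal{T}_e^+\cap\mathcal{K}^{\ast}|>\frac12|\mathcal{K}^{\ast}|$ for every $e\in E$; a three-tope committee is a tope committee with $|\mathcal{K}^{\ast}|=3$. -}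

module Defs where

open import Data.Fin.Base using (Fin)
open import Data.Fin.Subset using (Subset; Side; inside; outside; ⊤; _∪_)
open import Data.Fin.Subset.Properties using (∪-comm)
open import Data.List.Base using (List; length)
import Data.List.Membership.Propositional as List
open import Data.List.Relation.Unary.Unique.Propositional using (Unique)
open import Data.Nat.Base using (ℕ; _*_; _<_)
open import Data.Product.Base using (Σ-syntax; ∃-syntax; _×_; _,_)
open import Data.Sum.Base using (_⊎_)
open import Data.Vec.Base using (Vec; lookup; map; replicate; zipWith)
open import Level using (0ℓ)
open import Relation.Binary.Core using (Rel)
open import Relation.Binary.Definitions using (Symmetric)
open import Relation.Binary.PropositionalEquality
  using (_≡_; _≢_; refl; sym; trans)
open import Relation.Nullary.Negation using (¬_)
open import Relation.Unary as Pred using (Pred; _⊆_; _≐_; _∩_; ｛_｝)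

------------------------------------------------------------------------
-- Sign vectors on the ground set E = Fin n

data Sign : Set where
  - 𝟘 + : Sign

opposite : Sign → Sign
opposite - = +
opposite 𝟘 = 𝟘
opposite + = -

_∘ˢ_ : Sign → Sign → Sign
- ∘ˢ _ = -
𝟘 ∘ˢ t = t
+ ∘ˢ _ = +

SignVector : ℕ → Set
SignVector = Vec Sign

module _ {n : ℕ} where

  infixl 20 _at_
  _at_ : SignVector n → Fin n → Sign
  X at e = lookup X e

  negate : SignVector n → SignVector n
  negate = map opposite

  compose : SignVector n → SignVector n → SignVector n
  compose = zipWith _∘ˢ_

  -- e lies in the separation set S(X, Y).
  Separates : Fin n → SignVector n → SignVector n → Set
  Separates e X Y = X at e ≢ 𝟘 × X at e ≡ opposite (Y at e)

  infix 4 _≼_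
  _≼_ : Rel (SignVector n) 0ℓ
  X ≼ Y = ∀ e → X at e ≡ 𝟘 ⊎ X at e ≡ Y at e

  infix 30 _⁺
  _⁺ : SignVector n → Subset n
  F ⁺ = map positive F
    where
    positive : Sign → Side
    positive - = outside
    positive 𝟘 = outside
    positive + = inside

------------------------------------------------------------------------
-- Oriented matroids, by the covector axioms

record OrientedMatroid (n : ℕ) : Set₁ where
  field
    Covector    : Pred (SignVector n) 0ℓ
    zero-vector : Covector (replicate n 𝟘)
    symmetry    : ∀ {X} → Covector X → Covector (negate X)
    composition : ∀ {X Y} → Covector X → Covector Y → Covector (compose X Y)
    -- Off S(X, Y) the vectors compose X Y and compose Y X agree.
    elimination : ∀ {X Y e} → Covector X → Covector Y → Separates e X Y →
                  ∃[ Z ] Covector Z × Z at e ≡ 𝟘 ×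
                    (∀ f → ¬ Separates f X Y → Z at f ≡ compose X Y at f)

module _ {n : ℕ} (M : OrientedMatroid n) where
  open OrientedMatroid M

  IsLoop : Fin n → Set
  IsLoop e = ∀ {X} → Covector X → X at e ≡ 𝟘

  Parallel : Fin n → Fin n → Set
  Parallel e f = ∀ {X} → Covector X → X at e ≡ X at f

  Antiparallel : Fin n → Fin n → Set
  Antiparallel e f = ∀ {X} → Covector X → X at e ≡ opposite (X at f)

  record Simple : Set where
    field
      no-loops        : ∀ e → ¬ IsLoop e
      no-parallel     : ∀ {e f} → e ≢ f → ¬ Parallel e f
      no-antiparallel : ∀ {e f} → e ≢ f → ¬ Antiparallel e f

  Tope : Pred (SignVector n) 0ℓ
  Tope T = Covector T × (∀ {X} → Covector X → T ≼ X → T ≡ X)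

  Acyclic : Set
  Acyclic = Tope (replicate n +)

  PositiveHalfspace : Fin n → Pred (SignVector n) 0ℓ
  PositiveHalfspace e T = Tope T × T at e ≡ +

------------------------------------------------------------------------
-- Tope committees

-- Subsets are predicates; the cardinality of one is the length of a
-- repetition-free list of its elements.
HasCardinality : {A : Set} → Pred A 0ℓ → ℕ → Set
HasCardinality {A} P k =
  Σ[ xs ∈ List A ] Unique xs × (List._∈ xs) ≐ P × length xs ≡ k

module _ {n : ℕ} (M : OrientedMatroid n) where

  -- |𝒯ₑ⁺ ∩ K| > |K| / 2 is written without division as |K| < 2 |𝒯ₑ⁺ ∩ K|.
  IsTopeCommittee : Pred (SignVector n) 0ℓ → Set
  IsTopeCommittee K =
    K ⊆ Tope M ×
    (∃[ k ] HasCardinality K k ×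
      (∀ e → ∃[ a ] HasCardinality (PositiveHalfspace M e ∩ K) a × k < 2 * a))

  IsThreeTopeCommittee : Pred (SignVector n) 0ℓ → Set
  IsThreeTopeCommittee K = IsTopeCommittee K × HasCardinality K 3

------------------------------------------------------------------------
-- Simple graphs

-- The vertex set is a predicate on an ambient type A, so that vertices are
-- compared as elements of A, regardless of proofs of membership.
record SimpleGraph (A : Set) : Set₁ where
  field
    Vertex   : Pred A 0ℓ
    Adjacent : Rel A 0ℓ
    vertexˡ  : ∀ {x y} → Adjacent x y → Vertex x
    symmetric   : Symmetric Adjacent
    irreflexive : ∀ {x} → ¬ Adjacent x x

triple : {A : Set} → A → A → A → Pred A 0ℓ
triple x y z = ｛ x ｝ Pred.∪ ｛ y ｝ Pred.∪ ｛ z ｝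

module _ {A : Set} (G : SimpleGraph A) where
  open SimpleGraph G

  PairwiseAdjacent : A → A → A → Set
  PairwiseAdjacent x y z = Adjacent x y × Adjacent x z × Adjacent y z

  IsTriangleVertexSet : Pred A 0ℓ → Set
  IsTriangleVertexSet K =
    ∃[ x ] ∃[ y ] ∃[ z ] PairwiseAdjacent x y z × K ≐ triple x y z

𝚪 : ∀ {n} → OrientedMatroid n → SimpleGraph (SignVector n)
𝚪 M = record
  { Vertex      = Tope M
  ; Adjacent    = λ T′ T″ → Tope M T′ × Tope M T″ × T′ ≢ T″ × T′ ⁺ ∪ T″ ⁺ ≡ ⊤
  ; vertexˡ     = λ (t , _) → t
  ; symmetric   = λ {T′} {T″} (t′ , t″ , T′≢T″ , cover) →
      t″ , t′ , (λ eq → T′≢T″ (sym eq)) , trans (∪-comm (T″ ⁺) (T′ ⁺)) cover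
  ; irreflexive = λ (_ , _ , T≢T , _) → T≢T refl
  }

{-# OPTIONS --safe #-}
-- Three sign vectors form a committee exactly when at every e at least two of
-- them are positive, and this holds exactly when no two of them are both
-- non-positive at e, that is, when the positive parts of any two cover E.
module Submission where

open import Defs
open import Data.Fin.Base using (zero; suc)
open import Data.Fin.Properties using (injective⇒≤)
open import Data.Fin.Subset using (⊤; _∪_; _∈_; Side; inside)
open import Data.Fin.Subset.Properties
  using (∈⊤; ⊆-antisym; ⊆-max; x∈p∪q⁺; x∈p∪q⁻)
open import Data.List.Base using (List; []; _∷_; [_]; length; filter)
  renaming (lookup to lookupᴸ)
import Data.List.Membership.Propositional as List
open import Data.List.Membership.Propositional.Properties
  using (∈-lookup; ∈-filter⁺; ∈-filter⁻)
open import Data.List.Membership.Setoid.Properties using (index-injective)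
open import Data.List.Relation.Unary.All using ([]; _∷_) renaming (lookup to lookupᴬ)
open import Data.List.Relation.Unary.AllPairs using ([]; _∷_)
open import Data.List.Relation.Unary.Any using (here; there)
open import Data.List.Relation.Unary.Unique.Propositional using (Unique)
open import Data.List.Relation.Unary.Unique.Propositional.Properties using (filter⁺)
open import Data.Nat.Base using (ℕ; _≤_; _<_; _*_; s≤s)
open import Data.Nat.Properties using (*-monoʳ-≤; module ≤-Reasoning)
open import Data.Product.Base using (∃-syntax; _×_; _,_; map₂)
open import Data.Sum.Base using (_⊎_; inj₁; inj₂) renaming (map to ⊎-map)
open import Data.Vec.Base using (lookup)
open import Data.Vec.Properties using ([]=⇒lookup; lookup⇒[]=; lookup-map)
open import Function.Base using (_∘_; id)
open import Function.Bundles using (_⇔_; mk⇔; module Equivalence)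
open import Level using (0ℓ)
open import Relation.Binary.PropositionalEquality
  using (_≡_; _≢_; refl; sym; trans; cong; subst; setoid)
open import Relation.Nullary.Decidable using (Dec; yes; no)
open import Relation.Nullary.Negation using (¬_; contradiction)
open import Relation.Unary using (Pred; Decidable; _⊆_; _≐_; _∩_; ｛_｝)
open import Relation.Unary.Properties using (≐-sym; ≐-trans)

open Equivalence using (to; from)

module _ {A : Set} where

  lookup-injective : ∀ {xs : List A} → Unique xs →
                     ∀ i j → lookupᴸ xs i ≡ lookupᴸ xs j → i ≡ j
  lookup-injective (_ ∷ _)    zero    zero    _  = refl
  lookup-injective (x≢ ∷ _)   zero    (suc j) eq = contradiction eq (lookupᴬ x≢ (∈-lookup j))
  lookup-injective (x≢ ∷ _)   (suc i) zero    eq = contradiction (sym eq) (lookupᴬ x≢ (∈-lookup i))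
  lookup-injective (_ ∷ uniq) (suc i) (suc j) eq = cong suc (lookup-injective uniq i j eq)

  -- Each position in `xs` is sent to a position in `ys` holding the same element. This map is
  -- injective: a shared position in `ys` forces equal elements, and in a repetition-free `xs` an
  -- element determines its position.
  Unique-⊆⇒length-≤ : ∀ {xs ys : List A} → Unique xs →
                      (List._∈ xs) ⊆ (List._∈ ys) → length xs ≤ length ys
  Unique-⊆⇒length-≤ uniq xs⊆ys = injective⇒≤ λ {i} {j} eq →
    lookup-injective uniq i j
      (index-injective (setoid A) (xs⊆ys (∈-lookup i)) (xs⊆ys (∈-lookup j)) eq)

  HasCardinality-mono : ∀ {P Q : Pred A 0ℓ} {a b} → P ⊆ Q →
                        HasCardinality P a → HasCardinality Q b → a ≤ b
  HasCardinality-mono P⊆Q (_ , uniq , (xs⊆P , _) , refl) (_ , _ , (_ , Q⊆ys) , refl) =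
    Unique-⊆⇒length-≤ uniq (λ x∈xs → Q⊆ys (P⊆Q (xs⊆P x∈xs)))

  HasCardinality-resp-≐ : ∀ {P Q : Pred A 0ℓ} {a} → P ≐ Q →
                          HasCardinality P a → HasCardinality Q a
  HasCardinality-resp-≐ P≐Q (xs , uniq , xs≐P , len) = xs , uniq , ≐-trans xs≐P P≐Q , len

  -- Filtering the list that enumerates `Q` by `P?` keeps it repetition-free, so no decision
  -- procedure for `Q` is called for.
  HasCardinality-∩ : ∀ {P Q : Pred A 0ℓ} {a} → Decidable P →
                     HasCardinality Q a → ∃[ b ] HasCardinality (P ∩ Q) b
  HasCardinality-∩ P? (xs , uniq , (xs⊆Q , Q⊆xs) , _) =
    _ , filter P? xs , filter⁺ P? uniq ,
    ( (λ x∈ → let x∈xs , Px = ∈-filter⁻ P? x∈ in Px , xs⊆Q x∈xs)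
    , (λ (Px , Qx) → ∈-filter⁺ P? (Q⊆xs Qx) Px)
    ) , refl

  HasCardinality-singleton : ∀ (x : A) → HasCardinality ｛ x ｝ 1
  HasCardinality-singleton x =
    [ x ] , [] ∷ [] , ((λ { (here refl) → refl }) , (λ { refl → here refl })) , refl

  2≤HasCardinality : ∀ {P : Pred A 0ℓ} {a x y} → x ≢ y → P x → P y →
                     HasCardinality P a → 2 ≤ a
  2≤HasCardinality {x = x} {y} x≢y Px Py (_ , _ , (_ , P⊆xs) , refl) =
    Unique-⊆⇒length-≤ {x ∷ y ∷ []} ((x≢y ∷ []) ∷ [] ∷ [])
      λ { (here refl) → P⊆xs Px ; (there (here refl)) → P⊆xs Py }

  ∈-triple : ∀ {x y z : A} → (List._∈ (x ∷ y ∷ z ∷ [])) ≐ triple x y z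
  ∈-triple =
    (λ { (here refl)                 → inj₁ refl
       ; (there (here refl))         → inj₂ (inj₁ refl)
       ; (there (there (here refl))) → inj₂ (inj₂ refl) }) ,
    (λ { (inj₁ refl)        → here refl
       ; (inj₂ (inj₁ refl)) → there (here refl)
       ; (inj₂ (inj₂ refl)) → there (there (here refl)) })

  HasCardinality-triple : ∀ {x y z : A} → x ≢ y → x ≢ z → y ≢ z →
                          HasCardinality (triple x y z) 3
  HasCardinality-triple x≢y x≢z y≢z =
    _ , (x≢y ∷ x≢z ∷ []) ∷ (y≢z ∷ []) ∷ [] ∷ [] , ∈-triple , refl

  HasCardinality-3⇒triple : ∀ {P : Pred A 0ℓ} → HasCardinality P 3 →
    ∃[ x ] ∃[ y ] ∃[ z ] x ≢ y × x ≢ z × y ≢ z × P ≐ triple x y z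
  HasCardinality-3⇒triple
    (x ∷ y ∷ z ∷ [] , (x≢y ∷ x≢z ∷ []) ∷ (y≢z ∷ []) ∷ _ , xs≐P , refl) =
    x , y , z , x≢y , x≢z , y≢z , ≐-trans (≐-sym xs≐P) ∈-triple

  -- This inclusion and `triple-rotate` bring the pairs `x`, `z` and `y`, `z` to the front, so that
  -- one argument about the first two members yields all three edges.
  triple-swap : ∀ {x y z : A} → triple x y z ⊆ triple x z y
  triple-swap (inj₁ eq)        = inj₁ eq
  triple-swap (inj₂ (inj₁ eq)) = inj₂ (inj₂ eq)
  triple-swap (inj₂ (inj₂ eq)) = inj₂ (inj₁ eq)

  triple-rotate : ∀ {x y z : A} → triple x y z ⊆ triple y z x
  triple-rotate (inj₁ eq)        = inj₂ (inj₂ eq)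
  triple-rotate (inj₂ (inj₁ eq)) = inj₁ eq
  triple-rotate (inj₂ (inj₂ eq)) = inj₂ (inj₁ eq)

positive? : ∀ s → Dec (s ≡ +)
positive? - = no λ ()
positive? 𝟘 = no λ ()
positive? + = yes refl

module _ {n : ℕ} where

  ∈⁺⇔ : ∀ (F : SignVector n) e → e ∈ F ⁺ ⇔ F at e ≡ +
  ∈⁺⇔ F e = mk⇔ (λ e∈ → ⇒ ([]=⇒lookup e∈)) (λ eq → lookup⇒[]= e (F ⁺) (⇐ eq))
    where
    ⇒ : lookup (F ⁺) e ≡ inside → F at e ≡ +
    ⇒ eq with trans (sym (lookup-map e _ F)) eq
    -- For `-` and `𝟘` the equation `eq′` would identify `outside` with `inside`, which leaves only
    -- `+`.
    ... | eq′ with lookup F e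
    ... | + = refl

    ⇐ : F at e ≡ + → lookup (F ⁺) e ≡ inside
    -- The local function positive of _⁺ cannot be named here; unification finds it.
    ⇐ eq = let positive : Sign → Side; positive = _ in
      trans (lookup-map e positive F) (cong positive eq)

  PositiveAtOneOf : SignVector n → SignVector n → Set
  PositiveAtOneOf F G = ∀ e → F at e ≡ + ⊎ G at e ≡ +

  ⁺∪⁺≡⊤⇔ : ∀ (F G : SignVector n) → F ⁺ ∪ G ⁺ ≡ ⊤ ⇔ PositiveAtOneOf F G
  ⁺∪⁺≡⊤⇔ F G = mk⇔
    (λ eq e → ⊎-map (to (∈⁺⇔ F e)) (to (∈⁺⇔ G e))
                (x∈p∪q⁻ (F ⁺) (G ⁺) (subst (e ∈_) (sym eq) ∈⊤)))
    (λ pos → ⊆-antisym (⊆-max _)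
      (λ {e} _ → x∈p∪q⁺ (⊎-map (from (∈⁺⇔ F e)) (from (∈⁺⇔ G e)) (pos e))))

module _ {n : ℕ} (M : OrientedMatroid n) where

  -- A subset is a predicate, known only up to `≐`, so the committee property has to be transported
  -- between a set and its explicit triple.
  IsTopeCommittee-resp-≐ : ∀ {K L} → K ≐ L → IsTopeCommittee M K → IsTopeCommittee M L
  IsTopeCommittee-resp-≐ K≐L@(K⊆L , L⊆K) (topes , k , card , majority) =
    topes ∘ L⊆K , k , HasCardinality-resp-≐ K≐L card ,
    λ e → let a , card⁺ , k<2a = majority e in
      a , HasCardinality-resp-≐ (map₂ K⊆L , map₂ L⊆K) card⁺ , k<2a

  -- If `x` and `y` were both non-positive at `e`, only `z` could lie in the positive halfspace, and
  -- one member out of three is no majority.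
  committee⇒PositiveAtOneOf : ∀ {K x y z} → IsTopeCommittee M K → HasCardinality K 3 →
                              K ⊆ triple x y z → PositiveAtOneOf x y
  committee⇒PositiveAtOneOf {K} {x} {y} {z} (_ , k , card , majority) card₃ K⊆xyz e
    with positive? (x at e) | positive? (y at e)
  ... | yes x⁺ | _      = inj₁ x⁺
  ... | no _   | yes y⁺ = inj₂ y⁺
  ... | no ¬x⁺ | no ¬y⁺ with majority e
  ...   | a , card⁺ , k<2a = contradiction 3<2 λ { (s≤s (s≤s ())) }
    where
    K⁺⊆z : (PositiveHalfspace M e ∩ K) ⊆ ｛ z ｝
    K⁺⊆z ((_ , T⁺) , T∈K) with K⊆xyz T∈K
    ... | inj₁ refl        = contradiction T⁺ ¬x⁺
    ... | inj₂ (inj₁ refl) = contradiction T⁺ ¬y⁺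
    ... | inj₂ (inj₂ z≡T)  = z≡T

    open ≤-Reasoning
    3<2 : 3 < 2
    3<2 = begin-strict
      -- The committee carries its own count `k`; comparing two enumerations of the same `K` bounds
      -- it below by 3.
      3      ≤⟨ HasCardinality-mono id card₃ card ⟩
      k      <⟨ k<2a ⟩
      2 * a  ≤⟨ *-monoʳ-≤ 2 (HasCardinality-mono K⁺⊆z card⁺ (HasCardinality-singleton z)) ⟩
      2      ∎

  -- At each `e` the three pairwise conditions allow at most one non-positive member, so at least
  -- two of the three are positive.
  PositiveAtOneOf⇒committee : ∀ {x y z} → Tope M x → Tope M y → Tope M z →
    x ≢ y → x ≢ z → y ≢ z →
    PositiveAtOneOf x y → PositiveAtOneOf x z → PositiveAtOneOf y z →
    IsTopeCommittee M (triple x y z)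
  PositiveAtOneOf⇒committee {x} {y} {z} x-tope y-tope z-tope x≢y x≢z y≢z xy xz yz =
    topes , 3 , card , majority
    where
    topes : triple x y z ⊆ Tope M
    topes (inj₁ refl)        = x-tope
    topes (inj₂ (inj₁ refl)) = y-tope
    topes (inj₂ (inj₂ refl)) = z-tope

    card : HasCardinality (triple x y z) 3
    card = HasCardinality-triple x≢y x≢z y≢z

    majority : ∀ e → ∃[ a ] HasCardinality (PositiveHalfspace M e ∩ triple x y z) a × 3 < 2 * a
    majority e with HasCardinality-∩ (λ T → positive? (T at e)) card
    ... | a , card⁺ =
      -- The filter tests only the sign at `e`, since `Tope M` comes with no decision procedure;
      -- `topes` then restores the tope component of the halfspace.
      a , HasCardinality-resp-≐
            ((λ (T⁺ , T∈) → (topes T∈ , T⁺) , T∈) , (λ ((_ , T⁺) , T∈) → T⁺ , T∈)) card⁺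
        -- The goal `3 < 2 * a` unfolds to `4 ≤ 2 * a`, with 4 read as `2 * 2`.
        , *-monoʳ-≤ 2 2≤a
      where
      x∈ = inj₁ refl
      y∈ = inj₂ (inj₁ refl)
      z∈ = inj₂ (inj₂ refl)

      2≤a : 2 ≤ a
      -- Whichever of `x` and `y` the first condition makes positive, the condition on the pair that
      -- omits it supplies a second positive member.
      2≤a with xy e | xz e | yz e
      ... | inj₁ x⁺ | _       | inj₁ y⁺ = 2≤HasCardinality x≢y (x⁺ , x∈) (y⁺ , y∈) card⁺
      ... | inj₁ x⁺ | _       | inj₂ z⁺ = 2≤HasCardinality x≢z (x⁺ , x∈) (z⁺ , z∈) card⁺
      ... | inj₂ y⁺ | inj₁ x⁺ | _       = 2≤HasCardinality x≢y (x⁺ , x∈) (y⁺ , y∈) card⁺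
      ... | inj₂ y⁺ | inj₂ z⁺ | _       = 2≤HasCardinality y≢z (y⁺ , y∈) (z⁺ , z∈) card⁺

  committee⇔PairwiseAdjacent : ∀ {x y z} → Tope M x → Tope M y → Tope M z →
    x ≢ y → x ≢ z → y ≢ z →
    IsTopeCommittee M (triple x y z) ⇔ PairwiseAdjacent (𝚪 M) x y z
  committee⇔PairwiseAdjacent {x} {y} {z} x-tope y-tope z-tope x≢y x≢z y≢z = mk⇔
    (λ committee →
      let cover : ∀ {u v w} → triple x y z ⊆ triple u v w → u ⁺ ∪ v ⁺ ≡ ⊤
          cover ⊆uvw = from (⁺∪⁺≡⊤⇔ _ _)
            (committee⇒PositiveAtOneOf committee (HasCardinality-triple x≢y x≢z y≢z) ⊆uvw)
      in (x-tope , y-tope , x≢y , cover id)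
       , (x-tope , z-tope , x≢z , cover triple-swap)
       , (y-tope , z-tope , y≢z , cover triple-rotate))
    (λ ((_ , _ , _ , xy) , (_ , _ , _ , xz) , (_ , _ , _ , yz)) →
      PositiveAtOneOf⇒committee x-tope y-tope z-tope x≢y x≢z y≢z
        (to (⁺∪⁺≡⊤⇔ x y) xy) (to (⁺∪⁺≡⊤⇔ x z) xz) (to (⁺∪⁺≡⊤⇔ y z) yz))

  -- This reduces to explicit triples: an enumeration of length 3 names the members of a committee,
  -- and the edges of a triangle already record that its vertices are distinct topes.
  threeTopeCommittee⇔triangle : ∀ K →
    IsThreeTopeCommittee M K ⇔ IsTriangleVertexSet (𝚪 M) K
  threeTopeCommittee⇔triangle K = mk⇔ ⇒ ⇐
    where
    ⇒ : IsThreeTopeCommittee M K → IsTriangleVertexSet (𝚪 M) K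
    ⇒ (committee@(topes , _) , card₃) with HasCardinality-3⇒triple card₃
    ... | x , y , z , x≢y , x≢z , y≢z , K≐xyz@(_ , xyz⊆K) =
      x , y , z ,
      to (committee⇔PairwiseAdjacent
            (topes (xyz⊆K (inj₁ refl)))
            (topes (xyz⊆K (inj₂ (inj₁ refl))))
            (topes (xyz⊆K (inj₂ (inj₂ refl))))
            x≢y x≢z y≢z)
         (IsTopeCommittee-resp-≐ K≐xyz committee) ,
      K≐xyz

    ⇐ : IsTriangleVertexSet (𝚪 M) K → IsThreeTopeCommittee M K
    ⇐ (x , y , z , adjacent , K≐xyz) with adjacent
    ... | (x-tope , y-tope , x≢y , _) , (_ , z-tope , x≢z , _) , (_ , _ , y≢z , _) =
      IsTopeCommittee-resp-≐ (≐-sym K≐xyz)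
        (from (committee⇔PairwiseAdjacent x-tope y-tope z-tope x≢y x≢z y≢z) adjacent) ,
      HasCardinality-resp-≐ (≐-sym K≐xyz) (HasCardinality-triple x≢y x≢z y≢z)

mainTheorem1 : ∀ {n : ℕ} (M : OrientedMatroid n) → Simple M → ¬ Acyclic M →
    (∀ (K : Pred (SignVector n) 0ℓ) →
    IsThreeTopeCommittee M K ⇔ IsTriangleVertexSet (𝚪 M) K)
    ×
    (∀ {T₁ T₂ T₃ : SignVector n} → Tope M T₁ → Tope M T₂ → Tope M T₃ →
    T₁ ≢ T₂ → T₁ ≢ T₃ → T₂ ≢ T₃ →
    IsTopeCommittee M (triple T₁ T₂ T₃) ⇔ PairwiseAdjacent (𝚪 M) T₁ T₂ T₃)
mainTheorem1 M _ _ = threeTopeCommittee⇔triangle M , committee⇔PairwiseAdjacent M
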